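{- Let $N, k, g, n$ be positive integers. Suppose there is a modular Golomb ruler with $k$ marks modulo $N$, and suppose $g\mid N$. If $$n\le k-\left\lfloor \frac{g}{2}\right\rfloor,\qquad n=ag+r,\qquad 0\le r<g,$$ with $a,r$ integers, then $$G(g,n)\le \frac Ng-\left\lceil \frac{\frac Ng+\frac{g a(a-1)}2+ra}{n}\right\rceil.$$ The same bound is valid for every larger target multiplicity: for every integer $g'\ge g$, $G(g',n)$ is at most the same right-hand side (computed with the original $g,a,r$).
   Context: A finite set $\mathcal{G}\subset\mathbb{Z}$ is a $g$-Golomb ruler if for every positive integer $d$ the number of pairs $(a,c)\in \mathcal{G}^2$ with $c-a=d$ is at most $g$. $G(g,n)$ denotes the minimum possible diameter (largest element minus smallest element) of a $g$-Golomb ruler with exactly $n$ elements (marks). A set $\mathcal{A}$ of residues modulo $N$ is a modular $g$-Golomb ruler modulo $N$ if every nonzero residue modulo $N$ occurs at most $g$ times as a difference $a-a' \pmod N$ with $(a,a')$ an ordered pair of distinct elements of $\mathcal{A}$; its elements are called marks. A modular Golomb ruler is a modular $1$-Golomb ruler. -}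

module Defs where

open import Data.Fin.Base as Fin using (Fin; toℕ; fromℕ<)
import Data.Fin.Properties as Fin
open import Data.Integer.Base as ℤ using (ℤ; +_; 0ℤ; _%ℕ_)
import Data.Integer.Properties as ℤ
open import Data.Integer.Solver using (module +-*-Solver)
open import Data.List.Base using (List; []; _∷_; _++_; map; length; filter; cartesianProduct; upTo)
import Data.List.Properties as List
open import Data.List.Extrema ℤ.≤-totalOrder using (max; min; xs≤max; min≤xs; ⊥≤max; min≤⊤; max≤v⁺; v≤min⁺)
open import Data.List.Membership.Propositional using (_∈_)
open import Data.List.Membership.Propositional.Properties
  using (∈-map⁻; ∈-filter⁺; ∈-filter⁻; ∈-cartesianProduct⁻)
open import Data.List.Relation.Unary.All as All using (All; []; _∷_)
import Data.List.Relation.Unary.All.Properties as All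
open import Data.List.Relation.Unary.Any using (here; there)
open import Data.List.Relation.Unary.AllPairs using ([]; _∷_)
open import Data.List.Relation.Unary.Unique.Propositional using (Unique)
import Data.List.Relation.Unary.Unique.Propositional.Properties as Unique
open import Data.List.Relation.Unary.Unique.DecPropositional ℤ._≟_ using (unique?)
open import Data.Nat.Base as ℕ using (ℕ; zero; suc; NonZero; z≤n; s≤s)
open import Data.Nat.DivMod using (_/_)
import Data.Nat.Properties as ℕ
open import Data.Product.Base using (_×_; _,_; proj₁; proj₂; ∃)
import Data.Product.Base as Product
import Data.Rational.Unnormalised.Base as ℚᵘ
open import Function.Base using (_∘_)
open import Relation.Binary.Definitions using (tri<; tri≈; tri>)
open import Relation.Binary.PropositionalEquality
open import Relation.Nullary using (Dec; yes; no; ¬?; _×-dec_; _→-dec_; contradiction)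
open import Relation.Nullary.Decidable using (map′)
open import Relation.Unary using (Decidable)

-- A finite set is a duplicate-free list, so its cardinality is the length of
-- the list and ordered pairs are counted in the cartesian square.

#pairs : {A : Set} {P : A × A → Set} → Decidable P → List A → ℕ
#pairs P? xs = length (filter P? (cartesianProduct xs xs))

IsGolomb : ℕ → List ℤ → Set
IsGolomb g xs = ∀ d → 0ℤ ℤ.< d → #pairs (λ (a , c) → (c ℤ.- a) ℤ.≟ d) xs ℕ.≤ g

record Ruler (g n : ℕ) : Set where
  field
    marks  : List ℤ
    unique : Unique marks
    size   : length marks ≡ n
    golomb : IsGolomb g marks

-- The value at [] is a junk value.
diameter : List ℤ → ℕ
diameter []       = 0
diameter (x ∷ xs) = ℤ.∣ max x xs ℤ.- min x xs ∣

-- Residues are represented by Fin N; _%ℕ_ returns the representative in [0, N).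
IsModularGolomb : ∀ g N .{{_ : NonZero N}} → List (Fin N) → Set
IsModularGolomb g N xs = (d : Fin N) → toℕ d ≢ 0 →
  #pairs (λ (a , a′) → ¬? (a Fin.≟ a′) ×-dec
                        (((+ toℕ a ℤ.- + toℕ a′) %ℕ N) ℕ.≟ toℕ d)) xs ℕ.≤ g

record ModularRuler (g k N : ℕ) .{{_ : NonZero N}} : Set where
  field
    marks  : List (Fin N)
    unique : Unique marks
    size   : length marks ≡ k
    golomb : IsModularGolomb g N marks

IsMinDiameter : (g n m : ℕ) → Set
IsMinDiameter g n m =
  (∃ λ (R : Ruler g n) → diameter (Ruler.marks R) ≡ m) ×
  ((R : Ruler g n) → m ℕ.≤ diameter (Ruler.marks R))

-- The minimum exists.  A ruler exists because the powers of two form a Golomb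
-- ruler; a ruler of diameter d can be translated into {0, …, d}, where the
-- candidates can be searched exhaustively.

private

  least : {P : ℕ → Set} → Decidable P → ∀ d → P d → ∃ λ m → P m × (∀ j → P j → m ℕ.≤ j)
  least P? zero    p = 0 , p , λ _ _ → z≤n
  least P? (suc d) p with P? 0
  ... | yes p₀ = 0 , p₀ , λ _ _ → z≤n
  ... | no ¬p₀ with least (P? ∘ suc) d p
  ...   | m , pm , m≤ = suc m , pm , λ where
    zero    p₀ → contradiction p₀ ¬p₀
    (suc j) pj → s≤s (m≤ j pj)

  anyList? : ∀ {m} n {P : List (Fin m) → Set} → Decidable P → Dec (∃ λ xs → length xs ≡ n × P xs)
  anyList? zero P? = map′ (λ p → [] , refl , p) (λ { ([] , _ , p) → p }) (P? [])
  anyList? (suc n) P? = map′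
    (λ { (i , xs , eq , p) → i ∷ xs , cong suc eq , p })
    (λ { (i ∷ xs , eq , p) → i , xs , ℕ.suc-injective eq , p })
    (Fin.any? λ i → anyList? n (P? ∘ (i ∷_)))

  isGolomb? : ∀ g → Decidable (IsGolomb g)
  isGolomb? g xs = map′ to from (All.all? bounded? (cartesianProduct xs xs))
    where
    Bounded : ℤ × ℤ → Set
    Bounded (a , c) = 0ℤ ℤ.< c ℤ.- a → #pairs (λ (a′ , c′) → (c′ ℤ.- a′) ℤ.≟ (c ℤ.- a)) xs ℕ.≤ g

    bounded? : Decidable Bounded
    bounded? (a , c) = (0ℤ ℤ.<? (c ℤ.- a)) →-dec (_ ℕ.≤? g)

    to : All Bounded (cartesianProduct xs xs) → IsGolomb g xs
    to bs d 0<d = go _ refl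
      where
      D? : Decidable (λ ((a , c) : ℤ × ℤ) → c ℤ.- a ≡ d)
      D? (a , c) = (c ℤ.- a) ℤ.≟ d

      go : ∀ ps → ps ≡ filter D? (cartesianProduct xs xs) → #pairs D? xs ℕ.≤ g
      go []       eq = subst (λ ps → length ps ℕ.≤ g) eq z≤n
      go (p ∷ ps) eq with ∈-filter⁻ D? (subst (p ∈_) eq (here refl))
      ... | p∈ , refl = All.lookup bs p∈ 0<d

    from : IsGolomb g xs → All Bounded (cartesianProduct xs xs)
    from gol = All.universal (λ (a , c) → gol (c ℤ.- a)) _

  module _ {A B : Set} (f : A → B) where

    cartesianProduct-map : ∀ xs ys →
      cartesianProduct (map f xs) (map f ys) ≡ map (Product.map f f) (cartesianProduct xs ys)
    cartesianProduct-map []       ys = refl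
    cartesianProduct-map (x ∷ xs) ys = begin
      map (f x ,_) (map f ys) ++ cartesianProduct (map f xs) (map f ys)
        ≡⟨ cong₂ _++_ (trans (sym (List.map-∘ ys)) (List.map-∘ ys)) (cartesianProduct-map xs ys) ⟩
      map (Product.map f f) (map (x ,_) ys) ++ map (Product.map f f) (cartesianProduct xs ys)
        ≡⟨ List.map-++ _ (map (x ,_) ys) _ ⟨
      map (Product.map f f) (cartesianProduct (x ∷ xs) ys) ∎
      where open ≡-Reasoning

  -- Counting pairs is invariant under a change of variables.
  length-filter-map : {A B C : Set} {P : B → Set} {Q : C → Set} (P? : Decidable P) (Q? : Decidable Q)
    (f : A → B) (h : A → C) → (∀ x → P (f x) → Q (h x)) → (∀ x → Q (h x) → P (f x)) →
    ∀ xs → length (filter P? (map f xs)) ≡ length (filter Q? (map h xs))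
  length-filter-map P? Q? f h to from [] = refl
  length-filter-map P? Q? f h to from (x ∷ xs)
    with P? (f x) | Q? (h x) | length-filter-map P? Q? f h to from xs
  ... | yes p | yes q | eq = cong suc eq
  ... | yes p | no ¬q | eq = contradiction (to x p) ¬q
  ... | no ¬p | yes q | eq = contradiction (from x q) ¬p
  ... | no ¬p | no ¬q | eq = eq

  golomb-translate : ∀ {A : Set} {g} (f : A → ℤ) t xs →
    IsGolomb g (map (λ x → t ℤ.+ f x) xs) → IsGolomb g (map f xs)
  golomb-translate {g = g} f t xs gol d 0<d = subst (ℕ._≤ g) count (gol d 0<d)
    where
    f+ = λ x → t ℤ.+ f x
    D? : Decidable (λ ((a , c) : ℤ × ℤ) → c ℤ.- a ≡ d)
    D? (a , c) = (c ℤ.- a) ℤ.≟ d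

    shift : ∀ a c → (t ℤ.+ c) ℤ.- (t ℤ.+ a) ≡ c ℤ.- a
    shift a c = solve 3 (λ t a c → (t :+ c) :- (t :+ a) := c :- a) refl t a c
      where open +-*-Solver

    count : #pairs D? (map f+ xs) ≡ #pairs D? (map f xs)
    count = trans (cong (length ∘ filter D?) (cartesianProduct-map f+ xs xs))
      (trans (length-filter-map D? D? _ _
               (λ (x , y) eq → trans (sym (shift (f x) (f y))) eq)
               (λ (x , y) eq → trans (shift (f x) (f y)) eq)
               (cartesianProduct xs xs))
             (sym (cong (length ∘ filter D?) (cartesianProduct-map f xs xs))))

  ι : ∀ {m} → Fin m → ℤ
  ι i = + toℕ i

  ι-injective : ∀ {m} {i j : Fin m} → ι i ≡ ι j → i ≡ j
  ι-injective = Fin.toℕ-injective ∘ ℤ.+-injective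

  RulerWithin : (g n d : ℕ) → Set
  RulerWithin g n d = ∃ λ (is : List (Fin (suc d))) →
    length is ≡ n × Unique (map ι is) × IsGolomb g (map ι is)

  rulerWithin? : ∀ g n → Decidable (RulerWithin g n)
  rulerWithin? g n d = anyList? n λ is → unique? (map ι is) ×-dec isGolomb? g (map ι is)

  normalise : ∀ {g n} (R : Ruler g n) → RulerWithin g n (diameter (Ruler.marks R))
  normalise {g} record { marks = [] ; size = size ; golomb = golomb } = [] , size , [] , golomb
  normalise {g} record { marks = zs@(x ∷ xs) ; unique = unique ; size = size ; golomb = golomb } =
    let is , eq = shiftAll zs within in
      is
    , trans (sym (List.length-map _ is)) (trans (cong length eq) size)
    , Unique.map⁺ ι-injective (Unique.map⁻ (subst Unique (sym eq) unique))
    , golomb-translate ι lo is (subst (IsGolomb g) (sym eq) golomb)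
    where
    lo = min x xs
    hi = max x xs
    D  = diameter zs

    within : All (λ z → lo ℤ.≤ z × z ℤ.≤ hi) zs
    within = (min≤⊤ x xs , ⊥≤max x xs) ∷ All.zip (min≤xs x xs , xs≤max x xs)

    shiftOne : ∀ z → lo ℤ.≤ z → z ℤ.≤ hi → ∃ λ (i : Fin (suc D)) → lo ℤ.+ ι i ≡ z
    shiftOne z lo≤z z≤hi = fromℕ< (s≤s bound) , (begin
      lo ℤ.+ (+ toℕ (fromℕ< (s≤s bound))) ≡⟨ cong (λ m → lo ℤ.+ (+ m)) (Fin.toℕ-fromℕ< (s≤s bound)) ⟩
      lo ℤ.+ (+ ℤ.∣ z ℤ.- lo ∣)           ≡⟨ cong (λ i → lo ℤ.+ i) (ℤ.0≤i⇒+∣i∣≡i (ℤ.i≤j⇒0≤j-i lo≤z)) ⟩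
      lo ℤ.+ (z ℤ.- lo)                   ≡⟨ solve 2 (λ l z → l :+ (z :- l) := z) refl lo z ⟩
      z ∎)
      where
      open ≡-Reasoning
      open +-*-Solver
      bound : ℤ.∣ z ℤ.- lo ∣ ℕ.≤ D
      bound = ℤ.drop‿+≤+ (subst₂ ℤ._≤_
        (sym (ℤ.0≤i⇒+∣i∣≡i (ℤ.i≤j⇒0≤j-i lo≤z)))
        (sym (ℤ.0≤i⇒+∣i∣≡i (ℤ.i≤j⇒0≤j-i (ℤ.≤-trans lo≤z z≤hi))))
        (ℤ.+-monoˡ-≤ (ℤ.- lo) z≤hi))

    shiftAll : ∀ ys → All (λ z → lo ℤ.≤ z × z ℤ.≤ hi) ys →
      ∃ λ (is : List (Fin (suc D))) → map (λ i → lo ℤ.+ ι i) is ≡ ys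
    shiftAll []       []                    = [] , refl
    shiftAll (y ∷ ys) ((lo≤y , y≤hi) ∷ bs) =
      let i , eq = shiftOne y lo≤y y≤hi ; is , eqs = shiftAll ys bs
      in i ∷ is , cong₂ _∷_ eq eqs

  diameter-within : ∀ {d} (is : List (Fin (suc d))) → diameter (map ι is) ℕ.≤ d
  diameter-within []           = z≤n
  diameter-within {d} (i ∷ is) = ℤ.drop‿+≤+ (begin
    + ℤ.∣ hi ℤ.- lo ∣  ≡⟨ ℤ.0≤i⇒+∣i∣≡i (ℤ.i≤j⇒0≤j-i (ℤ.≤-trans (min≤⊤ (ι i) js) (⊥≤max (ι i) js))) ⟩
    hi ℤ.- lo          ≤⟨ ℤ.+-mono-≤ hi≤d (ℤ.neg-mono-≤ 0≤lo) ⟩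
    + d ℤ.+ 0ℤ         ≡⟨ ℤ.+-identityʳ (+ d) ⟩
    + d                ∎)
    where
    open ℤ.≤-Reasoning
    js = map ι is
    hi = max (ι i) js
    lo = min (ι i) js
    ι≤d : (j : Fin (suc d)) → ι j ℤ.≤ + d
    ι≤d j = ℤ.+≤+ (Fin.toℕ≤pred[n] j)
    hi≤d : hi ℤ.≤ + d
    hi≤d = max≤v⁺ (ι≤d i) (All.map⁺ (All.universal ι≤d is))
    0≤lo : 0ℤ ℤ.≤ lo
    0≤lo = v≤min⁺ (ℤ.+≤+ z≤n) (All.map⁺ (All.universal (λ _ → ℤ.+≤+ z≤n) is))

  2^-mono-≤ : ∀ {i j} → i ℕ.≤ j → 2 ℕ.^ i ℕ.≤ 2 ℕ.^ j
  2^-mono-≤ = ℕ.^-monoʳ-≤ 2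

  2^-mono-< : ∀ {i j} → i ℕ.< j → 2 ℕ.^ i ℕ.< 2 ℕ.^ j
  2^-mono-< = ℕ.^-monoʳ-< 2 (s≤s (s≤s z≤n))

  2^-cancel-< : ∀ {i j} → 2 ℕ.^ i ℕ.< 2 ℕ.^ j → i ℕ.< j
  2^-cancel-< {i} {j} lt with i ℕ.<? j
  ... | yes i<j = i<j
  ... | no  i≮j = contradiction lt (ℕ.≤⇒≯ (2^-mono-≤ (ℕ.≮⇒≥ i≮j)))

  2^-injective : ∀ {i j} → 2 ℕ.^ i ≡ 2 ℕ.^ j → i ≡ j
  2^-injective {i} {j} eq with ℕ.<-cmp i j
  ... | tri< i<j _ _ = contradiction eq (ℕ.<⇒≢ (2^-mono-< i<j))
  ... | tri≈ _ i≡j _ = i≡j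
  ... | tri> _ _ j<i = contradiction (sym eq) (ℕ.<⇒≢ (2^-mono-< j<i))

  -- 2^j + 2^k ≡ 2^l + 2^i says that 2^j − 2^i and 2^l − 2^k agree.
  sum-≮ : ∀ {i j k l} → i ℕ.< j → k ℕ.< l → 2 ℕ.^ j ℕ.+ 2 ℕ.^ k ≡ 2 ℕ.^ l ℕ.+ 2 ℕ.^ i → j ℕ.≮ l
  sum-≮ {i} {j} {k} {suc l} i<j (s≤s k≤l) eq (s≤s j≤l) = ℕ.<-irrefl eq (begin-strict
    2 ℕ.^ j ℕ.+ 2 ℕ.^ k     ≤⟨ ℕ.+-mono-≤ (2^-mono-≤ j≤l) (2^-mono-≤ k≤l) ⟩
    2 ℕ.^ l ℕ.+ 2 ℕ.^ l     ≡⟨ cong (2 ℕ.^ l ℕ.+_) (sym (ℕ.+-identityʳ _)) ⟩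
    2 ℕ.^ suc l             <⟨ ℕ.m<m+n _ (ℕ.m^n>0 2 i) ⟩
    2 ℕ.^ suc l ℕ.+ 2 ℕ.^ i ∎)
    where open ℕ.≤-Reasoning

  sum-unique : ∀ {i j k l} → i ℕ.< j → k ℕ.< l → 2 ℕ.^ j ℕ.+ 2 ℕ.^ k ≡ 2 ℕ.^ l ℕ.+ 2 ℕ.^ i → i ≡ k × j ≡ l
  sum-unique {i} {j} {k} {l} i<j k<l eq with ℕ.<-cmp j l
  ... | tri< j<l _ _  = contradiction j<l (sum-≮ i<j k<l eq)
  ... | tri≈ _ refl _ = sym (2^-injective (ℕ.+-cancelˡ-≡ (2 ℕ.^ j) _ _ eq)) , refl
  ... | tri> _ _ l<j  = contradiction l<j (sum-≮ k<l i<j (sym eq))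

  length≤1 : {A : Set} {xs : List A} → Unique xs → (∀ {x y} → x ∈ xs → y ∈ xs → x ≡ y) → length xs ℕ.≤ 1
  length≤1 {xs = []}         u eq = z≤n
  length≤1 {xs = x ∷ []}     u eq = s≤s z≤n
  length≤1 {xs = x ∷ y ∷ xs} ((x≢y ∷ _) ∷ _) eq = contradiction (eq (here refl) (there (here refl))) x≢y

  powers : ∀ g n .{{_ : NonZero g}} → Ruler g n
  powers g n = record
    { marks  = ps
    ; unique = ps!
    ; size   = trans (List.length-map pow (upTo n)) (List.length-upTo n)
    ; golomb = λ d 0<d → ℕ.≤-trans
        (length≤1 (Unique.filter⁺ (D? d) (Unique.cartesianProduct⁺ ps! ps!)) (same 0<d))
        (ℕ.>-nonZero⁻¹ g)
    }
    where
    pow : ℕ → ℤ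
    pow i = + (2 ℕ.^ i)

    ps = map pow (upTo n)

    ps! : Unique ps
    ps! = Unique.map⁺ (2^-injective ∘ ℤ.+-injective) (Unique.upTo⁺ n)

    D? : ∀ d → Decidable (λ ((a , c) : ℤ × ℤ) → c ℤ.- a ≡ d)
    D? d (a , c) = (c ℤ.- a) ℤ.≟ d

    ordered : ∀ {i j} → 0ℤ ℤ.< pow j ℤ.- pow i → i ℕ.< j
    ordered {i} {j} 0<d = 2^-cancel-< (ℤ.drop‿+<+ (subst₂ ℤ._<_ (ℤ.+-identityˡ (pow i))
      (solve 2 (λ p q → (q :- p) :+ p := q) refl (pow i) (pow j))
      (ℤ.+-monoˡ-< (pow i) 0<d)))
      where open +-*-Solver

    crossed : ∀ i j k l → pow j ℤ.- pow i ≡ pow l ℤ.- pow k → 2 ℕ.^ j ℕ.+ 2 ℕ.^ k ≡ 2 ℕ.^ l ℕ.+ 2 ℕ.^ i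
    crossed i j k l eq = ℤ.+-injective (begin
      pow j ℤ.+ pow k                           ≡⟨ solve 3 (λ p q r → q :+ r := (q :- p) :+ (p :+ r)) refl (pow i) (pow j) (pow k) ⟩
      (pow j ℤ.- pow i) ℤ.+ (pow i ℤ.+ pow k)   ≡⟨ cong (ℤ._+ (pow i ℤ.+ pow k)) eq ⟩
      (pow l ℤ.- pow k) ℤ.+ (pow i ℤ.+ pow k)   ≡⟨ solve 3 (λ p r s → (s :- r) :+ (p :+ r) := s :+ p) refl (pow i) (pow k) (pow l) ⟩
      pow l ℤ.+ pow i                           ∎)
      where
      open ≡-Reasoning
      open +-*-Solver

    same : ∀ {d} → 0ℤ ℤ.< d → ∀ {p q} →
      p ∈ filter (D? d) (cartesianProduct ps ps) → q ∈ filter (D? d) (cartesianProduct ps ps) → p ≡ q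
    same {d} 0<d p∈ q∈ with ∈-filter⁻ (D? d) p∈ | ∈-filter⁻ (D? d) q∈
    ... | p∈′ , refl | q∈′ , eq with ∈-cartesianProduct⁻ ps ps p∈′ | ∈-cartesianProduct⁻ ps ps q∈′
    ... | a∈ , b∈ | c∈ , d∈
      with ∈-map⁻ pow a∈ | ∈-map⁻ pow b∈ | ∈-map⁻ pow c∈ | ∈-map⁻ pow d∈
    ... | i , _ , refl | j , _ , refl | k , _ , refl | l , _ , refl
      with sum-unique (ordered {i} {j} 0<d) (ordered {k} {l} (subst (0ℤ ℤ.<_) (sym eq) 0<d)) (crossed i j k l (sym eq))
    ... | refl , refl = refl

minDiameter-exists : ∀ g n .{{_ : NonZero g}} → ∃ (IsMinDiameter g n)
minDiameter-exists g n =
  let m , (is , len , uniq , gol) , m≤ = least (rulerWithin? g n) _ (normalise (powers g n))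
      R = record { marks = map ι is ; unique = uniq
                 ; size = trans (List.length-map ι is) len ; golomb = gol }
  in m
   , (R , ℕ.≤-antisym (diameter-within is) (m≤ _ (normalise R)))
   , λ R′ → m≤ _ (normalise R′)

-- Meaningful for n ≥ 1 only, as the empty ruler has no diameter.
G : (g n : ℕ) .{{_ : NonZero g}} → ℕ
G g n = proj₁ (minDiameter-exists g n)

G-isMinDiameter : ∀ g n .{{_ : NonZero g}} → IsMinDiameter g n (G g n)
G-isMinDiameter g n = proj₂ (minDiameter-exists g n)

-- For g ∣ N both natural-number divisions are exact, a(a − 1) being even; for
-- a = 0 the truncated a ∸ 1 is harmless.
bound : (N g n a r : ℕ) .{{_ : NonZero g}} .{{_ : NonZero n}} → ℤ
bound N g n a r =
  + (N / g) ℤ.- ℚᵘ.ceiling ((+ (N / g ℕ.+ g ℕ.* (a ℕ.* (a ℕ.∸ 1)) / 2 ℕ.+ r ℕ.* a)) ℚᵘ./ n)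

{-# OPTIONS --safe #-}
-- Write M = N / g.  A nonzero residue modulo M has g lifts modulo N, so it is at
-- most g times a difference of the marks reduced modulo M, and the same count
-- for the residue 0 shows that at most ⌊ g /2⌋ marks have to be discarded to make
-- the reductions distinct.  Arranged cyclically, n of the remaining residues have
-- n gaps of total length M, each length being attained at most g times.  If L is
-- the longest gap, then M ≤ g (L + (L − 1) + … + (L − a + 1)) + r (L − a), which
-- bounds L from below, and cutting the circle at that gap leaves a g-Golomb ruler
-- of diameter M − L.
module Submission where

open import Defs
open import Data.Fin.Base using (Fin; toℕ; fromℕ<)
open import Data.Fin.Properties using (injective⇒≤; fromℕ<-injective; toℕ-fromℕ<; toℕ<n; toℕ-injective)
open import Data.Integer.Base as ℤ using (ℤ; 0ℤ; +_; _%ℕ_; _/ℕ_) renaming (_≤_ to _≤ℤ_)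
import Data.Integer.DivMod as ℤ
import Data.Integer.Divisibility.Signed as ℤ
import Data.Integer.Properties as ℤ
import Data.Integer.Tactic.RingSolver as ℤ
open import Data.List.Base using (List; []; _∷_; _++_; length; map; filter; take; lookup; cartesianProduct)
open import Data.List.Extrema ℤ.≤-totalOrder using (max; min; max≤v⁺; v≤min⁺; min≤⊤; ⊥≤max)
open import Data.List.Membership.Propositional using (_∈_; _∉_)
open import Data.List.Membership.Propositional.Properties
open import Data.List.Properties using (length-map; length-++; length-take; length-filter; map-∘; map-cong; take-map)
open import Data.List.Relation.Binary.Permutation.Propositional using (_↭_; ↭-sym; ↭⇒↭ₛ)
open import Data.List.Relation.Binary.Permutation.Propositional.Properties using (∈-resp-↭; ↭-length)
import Data.List.Relation.Binary.Permutation.Setoid.Properties as Permutation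
open import Data.List.Relation.Binary.Sublist.Propositional using () renaming (lookup to ⊆⇒∈)
import Data.List.Relation.Binary.Sublist.Propositional.Properties as Sublist
open import Data.List.Relation.Unary.All as All using (All; []; _∷_)
import Data.List.Relation.Unary.All.Properties as All
open import Data.List.Relation.Unary.AllPairs as AllPairs using (AllPairs; []; _∷_)
open import Data.List.Relation.Unary.Any using (here; there)
open import Data.List.Relation.Unary.Sorted.TotalOrder.Properties using (Sorted⇒AllPairs)
open import Data.List.Relation.Unary.Unique.Propositional using (Unique)
import Data.List.Relation.Unary.Unique.Propositional.Properties as Unique
open import Data.Nat.Base using (ℕ; zero; suc; NonZero; _+_; _*_; _∸_; _≤_; _<_; ⌊_/2⌋; z≤n; s≤s; >-nonZero⁻¹; ≢-nonZero⁻¹)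
open import Data.Nat.Divisibility using (_∣_; divides; >⇒∤)
open import Data.Nat.DivMod using (_/_; _%_; m≡m%n+[m/n]*n; m%n<n; m%n%n≡m%n; [m+n]%n≡m%n; m<n*o⇒m/o<n; m/n*n≤m; m*n/n≡m)
open import Data.Nat.ListAction using (sum)
open import Data.Nat.Properties
open import Data.List.Extrema ≤-totalOrder using (argmax; argmax-sel; f[⊥]≤f[argmax]; f[xs]≤f[argmax])
open import Data.List.Sort ≤-decTotalOrder using (sort; sort-↭; sort-↗)
open import Data.Nat.Tactic.RingSolver using (solve-∀)
open import Data.Product.Base using (_×_; _,_; proj₁; proj₂; ∃; swap)
import Data.Rational.Unnormalised.Base as ℚᵘ
open import Data.Sum.Base using (_⊎_; inj₁; inj₂; [_,_]′; map₁)
open import Function.Base using (_∘_; id)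
open import Data.List.Membership.DecPropositional _≟_ using (_∈?_)
open import Relation.Binary.PropositionalEquality
open import Relation.Unary using (Decidable)
open import Relation.Nullary using (yes; no; contradiction)

private variable
  A C : Set

-- Elementary counting

unique⇒lookup-injective : {xs : List A} → Unique xs → ∀ i j → lookup xs i ≡ lookup xs j → i ≡ j
unique⇒lookup-injective (x∉ ∷ xs!) Fin.zero    Fin.zero    eq = refl
unique⇒lookup-injective (x∉ ∷ xs!) Fin.zero    (Fin.suc j) eq = contradiction eq (All.lookup x∉ (∈-lookup j))
unique⇒lookup-injective (x∉ ∷ xs!) (Fin.suc i) Fin.zero    eq = contradiction (sym eq) (All.lookup x∉ (∈-lookup i))
unique⇒lookup-injective (x∉ ∷ xs!) (Fin.suc i) (Fin.suc j) eq = cong Fin.suc (unique⇒lookup-injective xs! i j eq)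

-- The index may depend on the membership proof, because it is later computed from a lift that only
-- such a proof provides. Injectivity is accordingly asked up to equality of elements.
pigeonhole-∈ : ∀ {m} {xs : List A} → Unique xs → (f : ∀ {x} → x ∈ xs → Fin m) →
  (∀ {x y} (x∈ : x ∈ xs) (y∈ : y ∈ xs) → f x∈ ≡ f y∈ → x ≡ y) → length xs ≤ m
pigeonhole-∈ xs! f f-inj = injective⇒≤ {f = λ i → f (∈-lookup i)} λ {i} {j} eq →
  unique⇒lookup-injective xs! i j (f-inj (∈-lookup i) (∈-lookup j) eq)

length≤1⇒≡ : {xs : List A} → length xs ≤ 1 → ∀ {x y} → x ∈ xs → y ∈ xs → x ≡ y
length≤1⇒≡ {xs = _ ∷ []} _ (here refl) (here refl) = refl
length≤1⇒≡ {xs = _ ∷ _ ∷ _} (s≤s ()) _ _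

-- Each discarded element is stored with the chosen element of equal value. When `f` is the residue
-- modulo `M`, every discarded mark thus exhibits a concrete pair of distinct marks that agree
-- modulo `M`.
record Transversal {A : Set} (f : A → ℕ) (xs : List A) : Set where
  field
    chosen     : List A
    discarded  : List (A × A)
    chosen⊆    : ∀ {x} → x ∈ chosen → x ∈ xs
    distinct   : Unique (map f chosen)
    unique     : Unique discarded
    collisions : ∀ {x y} → (x , y) ∈ discarded → x ∈ xs × x ∉ chosen × y ∈ chosen × f x ≡ f y
    size       : length chosen + length discarded ≡ length xs

transversal : (f : A → ℕ) {xs : List A} → Unique xs → Transversal f xs
transversal f [] = record
  { chosen = [] ; discarded = [] ; chosen⊆ = λ () ; distinct = [] ; unique = []
  ; collisions = λ () ; size = refl }
transversal f {x ∷ xs} (x∉ ∷ xs!) with transversal f xs!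
... | T with f x ∈? map f (Transversal.chosen T)
... | yes fx∈ = let y , y∈ , fx≡fy = ∈-map⁻ f fx∈ in record
  { chosen = chosen
  ; discarded = (x , y) ∷ discarded
  ; chosen⊆ = there ∘ chosen⊆
  ; distinct = distinct
  ; unique = All.tabulate (λ z∈ eq → new (proj₁ (collisions (subst (_∈ discarded) (sym eq) z∈)))) ∷ unique
  ; collisions = λ where
      (here refl) → here refl , new ∘ chosen⊆ , y∈ , fx≡fy
      (there z∈)  → let z∈xs , rest = collisions z∈ in there z∈xs , rest
  ; size = trans (+-suc _ _) (cong suc size)
  }
  where
  open Transversal T
  new : x ∉ xs
  new x∈ = All.lookup x∉ x∈ refl
... | no fx∉ = record
  { chosen = x ∷ chosen
  ; discarded = discarded
  ; chosen⊆ = λ { (here refl) → here refl ; (there z∈) → there (chosen⊆ z∈) }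
  ; distinct = All.tabulate (λ z∈ eq → fx∉ (subst (_∈ map f chosen) (sym eq) z∈)) ∷ distinct
  ; unique = unique
  ; collisions = λ z∈ → let z∈xs , z∉ , w∈ , eq = collisions z∈ in
      there z∈xs
    , (λ { (here refl) → All.lookup x∉ z∈xs refl ; (there z∈′) → z∉ z∈′ })
    , there w∈ , eq
  ; size = cong suc size
  }
  where open Transversal T

-- Values of bounded multiplicity

module _ (f : C → ℕ) where

  -- A value below `suc L` is either below `L` or equal to `L`, so the two filters partition the
  -- list.
  peel : ∀ {L} (<L? : Decidable (λ x → f x < L)) (≡L? : Decidable (λ x → f x ≡ L)) xs →
    All (λ x → f x < suc L) xs →
    sum (map f xs) ≡ sum (map f (filter <L? xs)) + length (filter ≡L? xs) * L
    × length xs ≡ length (filter <L? xs) + length (filter ≡L? xs)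
  peel <L? ≡L? [] [] = refl , refl
  peel {L} <L? ≡L? (x ∷ xs) (s≤s fx≤L ∷ all) with peel <L? ≡L? xs all | <L? x | ≡L? x
  ... | s , l | yes fx<L | yes fx≡L = contradiction fx≡L (<⇒≢ fx<L)
  ... | s , l | yes fx<L | no _ = trans (cong (λ s → f x + s) s) (sym (+-assoc (f x) _ _)) , cong suc l
  ... | s , l | no  fx≮L | no fx≢L = contradiction (≤∧≢⇒< fx≤L fx≢L) fx≮L
  ... | s , l | no _ | yes fx≡L =
    trans (cong₂ _+_ fx≡L s) (rearrange L (sum (map f (filter <L? xs))) _) , trans (cong suc l) (sym (+-suc _ _))
    where
    rearrange : ∀ L s m → L + (s + m) ≡ s + (L + m)
    rearrange = solve-∀

  sum+length≤ : ∀ L xs → All (λ x → f x < L) xs → sum (map f xs) + length xs ≤ length xs * L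
  sum+length≤ L [] [] = z≤n
  sum+length≤ L (x ∷ xs) (fx<L ∷ all) = begin
    f x + s + suc l     ≡⟨ rearrange (f x) s l ⟩
    suc (f x) + (s + l) ≤⟨ +-mono-≤ fx<L (sum+length≤ L xs all) ⟩
    L + l * L           ∎
    where
    open ≤-Reasoning
    s = sum (map f xs)
    l = length xs
    rearrange : ∀ y s l → y + s + suc l ≡ suc y + (s + l)
    rearrange = solve-∀

  -- At most g elements attain the largest value L − 1; removing them lowers
  -- both the bound L and the parameter a by one.  Both sides are doubled, so
  -- that a (a + 1) / 2 needs no division.
  multiplicity-bound : ∀ g a L xs → All (λ x → f x < L) xs →
    (∀ v → length (filter (λ x → f x ≟ v) xs) ≤ g) →
    2 * (sum (map f xs) + suc a * length xs) ≤ 2 * (length xs * L) + g * (a * suc a)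
  multiplicity-bound g zero L xs all mult = begin
    2 * (sum (map f xs) + (length xs + 0)) ≡⟨ cong (λ l → 2 * (sum (map f xs) + l)) (+-identityʳ (length xs)) ⟩
    2 * (sum (map f xs) + length xs)       ≤⟨ *-monoʳ-≤ 2 (sum+length≤ L xs all) ⟩
    2 * (length xs * L)                    ≤⟨ m≤m+n _ _ ⟩
    2 * (length xs * L) + g * 0            ∎
    where open ≤-Reasoning
  multiplicity-bound g (suc a) zero [] all mult = begin
    2 * (a * 0)               ≡⟨ cong (2 *_) (*-zeroʳ a) ⟩
    0                         ≤⟨ z≤n ⟩
    g * (suc a * suc (suc a)) ∎
    where open ≤-Reasoning
  multiplicity-bound g (suc a) zero (x ∷ xs) (() ∷ _) mult
  multiplicity-bound g (suc a) (suc L) xs all mult = begin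
    2 * (sum (map f xs) + suc (suc a) * length xs)
      ≡⟨ cong₂ (λ s l → 2 * (s + suc (suc a) * l)) (proj₁ peeled) (proj₂ peeled) ⟩
    2 * ((s + m * L) + suc (suc a) * (l + m))
      ≡⟨ split s l m a L ⟩
    -- The first summand is the left side of the induction hypothesis for the values below `L`, the
    -- second is estimated by `m ≤ g`, and the third is carried along unchanged.
    2 * (s + suc a * l) + 2 * (suc a * m) + 2 * (l + m + m * L)
      ≤⟨ +-monoˡ-≤ _ (+-mono-≤ ih (*-monoʳ-≤ 2 (*-monoʳ-≤ (suc a) (mult L)))) ⟩
    2 * (l * L) + g * (a * suc a) + 2 * (suc a * g) + 2 * (l + m + m * L)
      ≡⟨ merge g l m a L ⟩
    2 * ((l + m) * suc L) + g * (suc a * suc (suc a))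
      ≡⟨ cong (λ l → 2 * (l * suc L) + g * (suc a * suc (suc a))) (proj₂ peeled) ⟨
    2 * (length xs * suc L) + g * (suc a * suc (suc a)) ∎
    where
    open ≤-Reasoning
    below = filter (λ x → f x <? L) xs
    s = sum (map f below)
    l = length below
    m = length (filter (λ x → f x ≟ L) xs)
    peeled = peel (λ x → f x <? L) (λ x → f x ≟ L) xs all

    ih : 2 * (s + suc a * l) ≤ 2 * (l * L) + g * (a * suc a)
    ih = multiplicity-bound g a L below (All.all-filter (λ x → f x <? L) xs) λ v →
      ≤-trans (Sublist.length-mono-≤ (Sublist.filter⁺ (λ x → f x ≟ v) (λ x → f x ≟ v) (λ { refl → id })
                (Sublist.filter-⊆ (λ x → f x <? L) xs)))
              (mult v)

    split : ∀ s l m a L → 2 * ((s + m * L) + suc (suc a) * (l + m)) ≡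
      2 * (s + suc a * l) + 2 * (suc a * m) + 2 * (l + m + m * L)
    split = solve-∀

    merge : ∀ g l m a L → 2 * (l * L) + g * (a * suc a) + 2 * (suc a * g) + 2 * (l + m + m * L) ≡
      2 * ((l + m) * suc L) + g * (suc a * suc (suc a))
    merge = solve-∀

-- Maxima and sorting

maximal : (f : C → ℕ) (xs : List C) → 0 < length xs → ∃ λ x → x ∈ xs × All (λ y → f y ≤ f x) xs
maximal f (x ∷ xs) _ = argmax f x xs , selected , f[⊥]≤f[argmax] {f = f} x xs ∷ f[xs]≤f[argmax] {f = f} x xs
  where
  selected : argmax f x xs ∈ x ∷ xs
  selected with argmax-sel f x xs
  ... | inj₁ eq = here eq
  ... | inj₂ ∈xs = there ∈xs

sort< : (xs : List ℕ) → Unique xs → ∃ λ ys → ys ↭ xs × AllPairs _<_ ys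
sort< xs xs! = sort xs , sort-↭ xs , AllPairs.zipWith (λ (x≤y , x≢y) → ≤∧≢⇒< x≤y x≢y)
  ( Sorted⇒AllPairs ≤-totalOrder (sort-↗ xs)
  , Permutation.Unique-resp-↭ (setoid ℕ) (↭⇒↭ₛ (↭-sym (sort-↭ xs))) xs!)

-- Consecutive elements of a sorted list

-- The closing step to `e` accounts for the cyclic order: with `e = x + M` it leads from the largest
-- residue round to the smallest.
steps : ℕ → ℕ → List ℕ → List (ℕ × ℕ)
steps e x []       = (x , e) ∷ []
steps e x (y ∷ ys) = (x , y) ∷ steps e y ys

gap : ℕ × ℕ → ℕ
gap (u , v) = v ∸ u

-- The last component keeps all residues out of the open interval from `u` to `v`, which is what
-- makes it possible to cut the circle there.
Consecutive : ℕ → ℕ → List ℕ → ℕ × ℕ → Set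
Consecutive e x xs (u , v) =
  u ∈ x ∷ xs × (v ∈ xs ⊎ v ≡ e) × u < v × (∀ {w} → w ∈ x ∷ xs → w ≤ u ⊎ v ≤ w)

starts-steps : ∀ e x xs → map proj₁ (steps e x xs) ≡ x ∷ xs
starts-steps e x []       = refl
starts-steps e x (y ∷ ys) = cong (x ∷_) (starts-steps e y ys)

length-steps : ∀ e x xs → length (steps e x xs) ≡ suc (length xs)
length-steps e x xs = trans (sym (length-map proj₁ (steps e x xs))) (cong length (starts-steps e x xs))

steps-consecutive : ∀ {e x} xs → AllPairs _<_ (x ∷ xs) → All (_< e) (x ∷ xs) →
  All (Consecutive e x xs) (steps e x xs)
steps-consecutive [] _ (x<e ∷ _) = (here refl , inj₂ refl , x<e , λ { (here refl) → inj₁ ≤-refl }) ∷ []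
steps-consecutive (y ∷ ys) ((x<y ∷ x<ys) ∷ sorted@(y<ys ∷ _)) (x<e ∷ ys<e) =
  ( here refl , inj₁ (here refl) , x<y
  , λ { (here refl) → inj₁ ≤-refl
      ; (there (here refl)) → inj₂ ≤-refl
      ; (there (there w∈)) → inj₂ (<⇒≤ (All.lookup y<ys w∈)) }) ∷
  All.map
    (λ (u∈ , v∈ , u<v , between) →
        there u∈ , map₁ there v∈ , u<v
      , λ { (here refl) → inj₁ (<⇒≤ (All.lookup (x<y ∷ x<ys) u∈)) ; (there w∈) → between w∈ })
    (steps-consecutive ys sorted ys<e)

-- The gaps telescope; for `e = x + M` their total is one full turn `M`.
sum-gaps : ∀ {e x} xs → AllPairs _<_ (x ∷ xs) → All (_< e) (x ∷ xs) →
  x + sum (map gap (steps e x xs)) ≡ e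
sum-gaps {e} {x} [] _ (x<e ∷ _) = trans (cong (λ d → x + d) (+-identityʳ (e ∸ x))) (m+[n∸m]≡n (<⇒≤ x<e))
sum-gaps {e} {x} (y ∷ ys) ((x<y ∷ _) ∷ sorted) (_ ∷ ys<e) = begin
  x + (y ∸ x + s) ≡⟨ +-assoc x (y ∸ x) s ⟨
  x + (y ∸ x) + s ≡⟨ cong (_+ s) (m+[n∸m]≡n (<⇒≤ x<y)) ⟩
  y + s           ≡⟨ sum-gaps ys sorted ys<e ⟩
  e               ∎
  where
  open ≡-Reasoning
  s = sum (map gap (steps e y ys))

-- Only a step from `x` straight to `e` could have this length, and it would jump over `y`. Hence
-- with at least two residues no gap is a full turn, and each gap joins two different marks.
gap-proper : ∀ {e x y ys s} → AllPairs _<_ (x ∷ y ∷ ys) → All (_< e) (x ∷ y ∷ ys) →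
  Consecutive e x (y ∷ ys) s → gap s < e ∸ x
gap-proper {x = x} {s = u , v} (x<ys@(x<y ∷ _) ∷ _) (_ ∷ y<e ∷ ys<e) (u∈ , v∈ , u<v , between) = go u∈ v∈
  where
  go : u ∈ x ∷ _ → _ → v ∸ u < _ ∸ x
  go (here refl) (inj₁ v∈)   = ∸-monoˡ-< (All.lookup (y<e ∷ ys<e) v∈) (<⇒≤ u<v)
  go (here refl) (inj₂ refl) with between (there (here refl))
  ... | inj₁ y≤x = contradiction x<y (≤⇒≯ y≤x)
  ... | inj₂ e≤y = contradiction y<e (≤⇒≯ e≤y)
  go (there u∈)  (inj₁ v∈)   =
    ≤-<-trans (∸-monoʳ-≤ v (<⇒≤ (All.lookup x<ys u∈)))
              (∸-monoˡ-< (All.lookup (y<e ∷ ys<e) v∈) (<⇒≤ (All.lookup x<ys v∈)))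
  go (there u∈)  (inj₂ refl) = ∸-monoʳ-< (All.lookup x<ys u∈) (<⇒≤ u<v)

-- Congruences

n∣i-i%n : ∀ i n .{{_ : NonZero n}} → + n ℤ.∣ i ℤ.- + (i %ℕ n)
n∣i-i%n i n = ℤ.divides (i /ℕ n) (begin
  i ℤ.- + (i %ℕ n)                                     ≡⟨ cong (ℤ._- + (i %ℕ n)) (ℤ.a≡a%ℕn+[a/ℕn]*n i n) ⟩
  + (i %ℕ n) ℤ.+ (i /ℕ n) ℤ.* + n ℤ.- + (i %ℕ n)       ≡⟨ cancel (+ (i %ℕ n)) ((i /ℕ n) ℤ.* + n) ⟩
  (i /ℕ n) ℤ.* + n                                     ∎)
  where
  open ≡-Reasoning
  cancel : ∀ i j → i ℤ.+ j ℤ.- i ≡ j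
  cancel = ℤ.solve-∀

residue-unique : ∀ {n i j} → i < n → j < n → + n ℤ.∣ + i ℤ.- + j → i ≡ j
residue-unique {n} {i} {j} i<n j<n n∣i-j with ℤ.∣ + i ℤ.- + j ∣ in eq
... | zero  = ℤ.+-injective (ℤ.i-j≡0⇒i≡j (+ i) (+ j) (ℤ.∣i∣≡0⇒i≡0 eq))
... | suc d = contradiction (subst (n ∣_) eq (ℤ.∣⇒∣ᵤ n∣i-j)) (>⇒∤ (subst (_< n) eq bounded))
  where
  bounded : ℤ.∣ + i ℤ.- + j ∣ < n
  bounded with ≤-total i j
  ... | inj₁ i≤j rewrite ℤ.m-n≡m⊖n i j | ℤ.∣⊖∣-≤ i≤j = ≤-<-trans (m∸n≤m j i) j<n
  ... | inj₂ j≤i rewrite ℤ.m-n≡m⊖n i j | ℤ.∣m⊖n∣≡∣n⊖m∣ i j | ℤ.∣⊖∣-≤ j≤i = ≤-<-trans (m∸n≤m i j) i<n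

-- The congruence fixes the remainder, and the quotient then fixes the number.
/-%-unique : ∀ {n i j} .{{_ : NonZero n}} → i / n ≡ j / n → + n ℤ.∣ + i ℤ.- + j → i ≡ j
/-%-unique {n} {i} {j} i/n≡j/n n∣i-j = begin
  i                 ≡⟨ m≡m%n+[m/n]*n i n ⟩
  i % n + i / n * n ≡⟨ cong₂ (λ r q → r + q * n) (residue-unique (m%n<n i n) (m%n<n j n) n∣i%n-j%n) i/n≡j/n ⟩
  j % n + j / n * n ≡⟨ m≡m%n+[m/n]*n j n ⟨
  j                 ∎
  where
  open ≡-Reasoning
  rearrange : ∀ a b a′ b′ → (a ℤ.- b) ℤ.- (a ℤ.- a′) ℤ.+ (b ℤ.- b′) ≡ a′ ℤ.- b′
  rearrange = ℤ.solve-∀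
  n∣i%n-j%n : + n ℤ.∣ + (i % n) ℤ.- + (j % n)
  n∣i%n-j%n = subst (+ n ℤ.∣_) (rearrange (+ i) (+ j) (+ (i % n)) (+ (j % n)))
    (ℤ.∣m∣n⇒∣m+n (ℤ.∣m∣n⇒∣m-n n∣i-j (n∣i-i%n (+ i) n)) (n∣i-i%n (+ j) n))

-- For residues u and w modulo M, the representative of w in the window (u, u + M].

wrap : (M u w : ℕ) → ℕ
wrap M u w with w ≤? u
... | yes _ = w + M
... | no  _ = w

wrap-% : ∀ M u w .{{_ : NonZero M}} → wrap M u w % M ≡ w % M
wrap-% M u w with w ≤? u
... | yes _ = [m+n]%n≡m%n w M
... | no  _ = refl

-- A residue `w ≤ u` is raised by `M`, and the last hypothesis carries it to `v` or beyond; any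
-- other residue is already at least `v`, because none lies strictly between `u` and `v`. The window
-- thus shrinks by the length of the gap.
wrap-bounds : ∀ {M u v w} → w < M → w ≤ u ⊎ v ≤ w → v ≤ w + M → v ≤ wrap M u w × wrap M u w ≤ u + M
wrap-bounds {M} {u} {v} {w} w<M between v≤w+M with w ≤? u
... | yes w≤u = v≤w+M , +-monoˡ-≤ M w≤u
... | no  w≰u with between
...   | inj₁ w≤u = contradiction w≤u w≰u
...   | inj₂ v≤w = v≤w , ≤-trans (<⇒≤ w<M) (m≤n+m M u)

-- Estimates for the diameter and the ceiling

diameter≤ : ∀ {lo hi} xs → lo ≤ℤ hi → All (λ z → lo ≤ℤ z × z ≤ℤ hi) xs → + diameter xs ≤ℤ hi ℤ.- lo
-- The empty list has diameter 0 by convention, so the interval length only has to be nonnegative.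
diameter≤ [] lo≤hi _ = ℤ.i≤j⇒0≤j-i lo≤hi
diameter≤ {lo} {hi} (x ∷ xs) lo≤hi bs@((lo≤x , x≤hi) ∷ bs′) = begin
  + ℤ.∣ max x xs ℤ.- min x xs ∣ ≡⟨ ℤ.0≤i⇒+∣i∣≡i (ℤ.i≤j⇒0≤j-i (ℤ.≤-trans (min≤⊤ x xs) (⊥≤max x xs))) ⟩
  max x xs ℤ.- min x xs         ≤⟨ ℤ.+-mono-≤ (max≤v⁺ x≤hi (All.map proj₂ bs′)) (ℤ.neg-mono-≤ (v≤min⁺ lo≤x (All.map proj₁ bs′))) ⟩
  hi ℤ.- lo                     ∎
  where open ℤ.≤-Reasoning

-- The ceiling unfolds to minus the floor `q` of `- s / n`. If `q < - l`, then `suc q * n` is at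
-- most `- (n * l)`, hence at most `- s`, against the defining property of the quotient.
ceiling-/≤ : ∀ s n l .{{_ : NonZero n}} → s ≤ n * l → ℚᵘ.ceiling (+ s ℚᵘ./ n) ≤ℤ + l
ceiling-/≤ s n@(suc _) l s≤nl = subst (ℤ.- q ≤ℤ_) (ℤ.neg-involutive (+ l)) (ℤ.neg-mono-≤ -l≤q)
  where
  q = (ℤ.- + s) ℤ./ + n

  -l≤q : ℤ.- + l ≤ℤ q
  -l≤q with ℤ.- + l ℤ.≤? q
  ... | yes p = p
  ... | no ¬p = contradiction (begin-strict
    ℤ.- + s              <⟨ ℤ.n<s[n/ℕd]*d (ℤ.- + s) n ⟩
    ℤ.suc ((ℤ.- + s) ℤ./ℕ n) ℤ.* + n ≡⟨ cong (λ q → ℤ.suc q ℤ.* + n) (ℤ.div-pos-is-/ℕ (ℤ.- + s) n) ⟨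
    ℤ.suc q ℤ.* + n      ≤⟨ ℤ.*-monoʳ-≤-nonNeg (+ n) (ℤ.i<j⇒suc[i]≤j (ℤ.≰⇒> ¬p)) ⟩
    (ℤ.- + l) ℤ.* + n    ≡⟨ ℤ.neg-distribˡ-* (+ l) (+ n) ⟨
    ℤ.- (+ l ℤ.* + n)    ≡⟨ cong ℤ.-_ (trans (sym (ℤ.pos-* l n)) (cong +_ (*-comm l n))) ⟩
    ℤ.- + (n * l)        ≤⟨ ℤ.neg-mono-≤ (ℤ.+≤+ s≤nl) ⟩
    ℤ.- + s              ∎) (ℤ.<-irrefl refl)
    where open ℤ.≤-Reasoning

-- Reducing a modular Golomb ruler modulo a divisor

module Reduction {M g k : ℕ} .{{_ : NonZero M}} .{{_ : NonZero g}} .{{_ : NonZero (M * g)}} (R : ModularRuler 1 k (M * g)) where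

  open ModularRuler R

  N : ℕ
  N = M * g

  residue : Fin N → ℕ
  residue b = toℕ b % M

  -- The marks have to be distinct, but their residues modulo `M` may agree. The case `d = 0`
  -- therefore describes the collisions.
  Difference : ℤ → Fin N × Fin N → Set
  Difference d (b , c) = b ∈ marks × c ∈ marks × b ≢ c × + M ℤ.∣ (+ toℕ c ℤ.- + toℕ b) ℤ.- d

  -- Among the residues modulo M g, exactly g reduce to d modulo M; the quotient
  -- by M of the difference tells which of them is attained, and each is attained
  -- at most once.
  differences≤g : (F : Fin N × Fin N → C) → ∀ {ps} d → Unique ps →
    (∀ {p} → p ∈ ps → ∃ λ bc → p ≡ F bc × Difference d bc) → length ps ≤ g
  differences≤g F {ps} d ps! lift = pigeonhole-∈ ps! index index-injective
    where
    e : Fin N × Fin N → ℕ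
    e (b , c) = (+ toℕ c ℤ.- + toℕ b) %ℕ N

    e<N : ∀ bc → e bc < N
    e<N (b , c) = ℤ.n%ℕd<d (+ toℕ c ℤ.- + toℕ b) N

    e/M<g : ∀ bc → e bc / M < g
    e/M<g bc = m<n*o⇒m/o<n (subst (e bc <_) (*-comm M g) (e<N bc))

    index : ∀ {p} → p ∈ ps → Fin g
    index p∈ = fromℕ< (e/M<g (proj₁ (lift p∈)))

    M∣ : ∀ b c → + M ℤ.∣ (+ toℕ c ℤ.- + toℕ b) ℤ.- + e (b , c)
    M∣ b c = ℤ.∣-trans (ℤ.divides (+ g) (trans (ℤ.pos-* M g) (ℤ.*-comm (+ M) (+ g)))) (n∣i-i%n (+ toℕ c ℤ.- + toℕ b) N)

    -- The Golomb condition concerns nonzero residues only. If `e` vanished, `N` would divide the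
    -- difference of two numbers below `N`, and the marks would coincide.
    e≢0 : ∀ b c → b ≢ c → e (b , c) ≢ 0
    e≢0 b c b≢c e≡0 = b≢c (sym (toℕ-injective (residue-unique (toℕ<n c) (toℕ<n b)
      (subst (+ N ℤ.∣_) (trans (cong (λ r → (+ toℕ c ℤ.- + toℕ b) ℤ.- + r) e≡0) (ℤ.+-identityʳ _))
        (n∣i-i%n (+ toℕ c ℤ.- + toℕ b) N)))))

    e-congruent : ∀ {bc b′c′} → Difference d bc → Difference d b′c′ → + M ℤ.∣ + e bc ℤ.- + e b′c′
    e-congruent {b , c} {b′ , c′} (_ , _ , _ , M∣bc) (_ , _ , _ , M∣b′c′) = subst (+ M ℤ.∣_)
      (rearrange (+ toℕ c ℤ.- + toℕ b) (+ toℕ c′ ℤ.- + toℕ b′) d (+ e (b , c)) (+ e (b′ , c′)))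
      (ℤ.∣m∣n⇒∣m+n (ℤ.∣m∣n⇒∣m-n M∣bc (M∣ b c)) (ℤ.∣m∣n⇒∣m-n (M∣ b′ c′) M∣b′c′))
      where
      rearrange : ∀ x y d i j → (x ℤ.- d) ℤ.- (x ℤ.- i) ℤ.+ ((y ℤ.- j) ℤ.- (y ℤ.- d)) ≡ i ℤ.- j
      rearrange = ℤ.solve-∀

    e-injective : ∀ {bc b′c′} → Difference d bc → Difference d b′c′ → e bc ≡ e b′c′ → bc ≡ b′c′
    e-injective {b , c} {b′ , c′} (b∈ , c∈ , b≢c , _) (b′∈ , c′∈ , b′≢c′ , _) eq =
      -- The modular condition counts `(a , a′)` by `a - a′`, so the difference of `c` and `b` is
      -- found at the pair `(c , b)`.
      cong swap (length≤1⇒≡ (golomb (fromℕ< (e<N (b , c))) (e≢0 b c b≢c ∘ trans (sym toℕ-e)))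
        (∈-filter⁺ _ (∈-cartesianProduct⁺ c∈ b∈) ((b≢c ∘ sym) , sym toℕ-e))
        (∈-filter⁺ _ (∈-cartesianProduct⁺ c′∈ b′∈) ((b′≢c′ ∘ sym) , trans (sym eq) (sym toℕ-e))))
      where
      toℕ-e : toℕ (fromℕ< (e<N (b , c))) ≡ e (b , c)
      toℕ-e = toℕ-fromℕ< (e<N (b , c))

    index-injective : ∀ {p q} (p∈ : p ∈ ps) (q∈ : q ∈ ps) → index p∈ ≡ index q∈ → p ≡ q
    index-injective p∈ q∈ eq with lift p∈ | lift q∈
    ... | bc , p≡ , D | b′c′ , q≡ , D′ = trans p≡ (trans (cong F (e-injective D D′ (/-%-unique
      (fromℕ<-injective _ _ (e/M<g bc) (e/M<g b′c′) eq) (e-congruent D D′)))) (sym q≡))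

  residues-agree : ∀ {b c} → residue b ≡ residue c → + M ℤ.∣ (+ toℕ c ℤ.- + toℕ b) ℤ.- 0ℤ
  residues-agree {b} {c} eq = subst (+ M ℤ.∣_)
    (trans (cong (λ r → (+ toℕ c ℤ.- + residue c) ℤ.- (+ toℕ b ℤ.- + r)) eq)
           (rearrange (+ toℕ c) (+ toℕ b) (+ residue c)))
    (ℤ.∣m∣n⇒∣m-n (n∣i-i%n (+ toℕ c) M) (n∣i-i%n (+ toℕ b) M))
    where
    rearrange : ∀ x y r → (x ℤ.- r) ℤ.- (y ℤ.- r) ≡ (x ℤ.- y) ℤ.- 0ℤ
    rearrange = ℤ.solve-∀

  -- Discarding marks until the residues are distinct

  module T = Transversal (transversal residue unique)

  -- Every collision contributes two ordered pairs whose difference is 0 modulo M.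
  discarded≤⌊g/2⌋ : length T.discarded ≤ ⌊ g /2⌋
  discarded≤⌊g/2⌋ = begin
    length T.discarded                           ≡⟨ n≡⌊n+n/2⌋ _ ⟩
    ⌊ length T.discarded + length T.discarded /2⌋ ≡⟨ cong ⌊_/2⌋ both-length ⟨
    ⌊ length both /2⌋                             ≤⟨ ⌊n/2⌋-mono (differences≤g id 0ℤ both! lift) ⟩
    ⌊ g /2⌋                                       ∎
    where
    open ≤-Reasoning
    both = T.discarded ++ map swap T.discarded

    both-length : length both ≡ length T.discarded + length T.discarded
    both-length = trans (length-++ T.discarded) (cong (λ l → length T.discarded + l) (length-map swap T.discarded))

    both! : Unique both
    -- The two halves are disjoint: the first entry of a discarded pair is not chosen, whereas that
    -- of a swapped pair is.
    both! = Unique.++⁺ T.unique (Unique.map⁺ (cong swap) T.unique) λ (p∈ , p∈′) →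
      let (x , y) , q∈ , eq = ∈-map⁻ swap p∈′
          _ , x∉ , _ = T.collisions p∈
          _ , _ , y∈ , _ = T.collisions q∈
      in x∉ (subst (_∈ T.chosen) (sym (cong proj₁ eq)) y∈)

    lift : ∀ {p} → p ∈ both → ∃ λ bc → p ≡ bc × Difference 0ℤ bc
    lift {b , c} p∈ with ∈-++⁻ T.discarded p∈
    ... | inj₁ p∈ = let b∈ , b∉ , c∈ , eq = T.collisions p∈ in
      _ , refl , b∈ , T.chosen⊆ c∈ , (λ { refl → b∉ c∈ }) , residues-agree eq
    ... | inj₂ p∈ with ∈-map⁻ swap p∈
    ...   | _ , q∈ , refl = let c∈ , c∉ , b∈ , eq = T.collisions q∈ in
      _ , refl , T.chosen⊆ b∈ , c∈ , (λ { refl → c∉ b∈ }) , residues-agree (sym eq)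

  k∸⌊g/2⌋≤chosen : k ∸ ⌊ g /2⌋ ≤ length T.chosen
  k∸⌊g/2⌋≤chosen = m≤n+o⇒m∸n≤o k ⌊ g /2⌋ (begin
    k                                        ≡⟨ trans T.size size ⟨
    length T.chosen + length T.discarded     ≤⟨ +-monoʳ-≤ (length T.chosen) discarded≤⌊g/2⌋ ⟩
    length T.chosen + ⌊ g /2⌋                ≡⟨ +-comm (length T.chosen) ⌊ g /2⌋ ⟩
    ⌊ g /2⌋ + length T.chosen                ∎)
    where open ≤-Reasoning

  -- Cutting the circle of residues at a point

  module Cut (bs : List (Fin N)) (bs⊆ : ∀ {b} → b ∈ bs → b ∈ marks) (distinct : Unique (map residue bs)) (u : ℕ) where

    mark : Fin N → ℤ
    mark b = + wrap M u (residue b)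

    cut : List ℤ
    cut = map mark bs

    M∣toℕ-mark : ∀ b → + M ℤ.∣ + toℕ b ℤ.- mark b
    M∣toℕ-mark b = subst (+ M ℤ.∣_) (telescope (+ toℕ b) (+ residue b) (mark b))
      (ℤ.∣m∣n⇒∣m-n (n∣i-i%n (+ toℕ b) M)
        (subst (λ r → + M ℤ.∣ mark b ℤ.- + r)
          (trans (wrap-% M u (residue b)) (m%n%n≡m%n (toℕ b) M))
          (n∣i-i%n (+ wrap M u (residue b)) M)))
      where
      telescope : ∀ x y z → (x ℤ.- y) ℤ.- (z ℤ.- y) ≡ x ℤ.- z
      telescope = ℤ.solve-∀

    -- Reduction modulo `M` undoes the wrapping, so marks inherit distinctness from their residues.
    -- The absolute value only turns the marks back into naturals.
    cut! : Unique cut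
    cut! = Unique.map⁻ {f = λ z → ℤ.∣ z ∣ % M} (subst Unique
      (trans (map-cong (λ b → trans (sym (m%n%n≡m%n (toℕ b) M)) (sym (wrap-% M u (residue b)))) bs) (map-∘ bs))
      distinct)

    -- Wrapping preserves the class modulo `M`, so two marks at distance `d` come from an original
    -- pair with difference `d` modulo `M`, and `differences≤g` counts those. This holds for every
    -- cut point `u`.
    cut-golomb : IsGolomb g cut
    cut-golomb d 0<d = differences≤g (λ (b , c) → mark b , mark c) d
      (Unique.filter⁺ D? (Unique.cartesianProduct⁺ cut! cut!)) lift
      where
      D? : Decidable (λ ((a , c) : ℤ × ℤ) → c ℤ.- a ≡ d)
      D? (a , c) = (c ℤ.- a) ℤ.≟ d

      lift : ∀ {p} → p ∈ filter D? (cartesianProduct cut cut) →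
        ∃ λ bc → p ≡ (mark (proj₁ bc) , mark (proj₂ bc)) × Difference d bc
      lift p∈ with ∈-filter⁻ D? p∈
      ... | p∈ , refl with ∈-cartesianProduct⁻ cut cut p∈
      ... | a∈ , c∈ with ∈-map⁻ mark a∈ | ∈-map⁻ mark c∈
      ... | b , b∈ , refl | c , c∈ , refl = (b , c) , refl , bs⊆ b∈ , bs⊆ c∈
        , (λ { refl → ℤ.<-irrefl (sym (ℤ.i≡j⇒i-j≡0 {mark b} refl)) 0<d })
        , subst (+ M ℤ.∣_) (rearrange (+ toℕ b) (+ toℕ c) (mark b) (mark c))
            (ℤ.∣m∣n⇒∣m-n (M∣toℕ-mark c) (M∣toℕ-mark b))
        where
        rearrange : ∀ b c x y → (c ℤ.- y) ℤ.- (b ℤ.- x) ≡ (c ℤ.- b) ℤ.- (y ℤ.- x)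
        rearrange = ℤ.solve-∀

  -- The cyclic gaps and the longest of them

  module _ (bs : List (Fin N)) (bs⊆ : ∀ {b} → b ∈ bs → b ∈ marks) (distinct : Unique (map residue bs))
           {x : ℕ} {xs : List ℕ} (x∷xs↭ : x ∷ xs ↭ map residue bs) (sorted : AllPairs _<_ (x ∷ xs)) where

    private
      S = steps (x + M) x xs

      preimage : ∀ {w} → w ∈ x ∷ xs → ∃ λ b → b ∈ bs × w ≡ residue b
      preimage w∈ = ∈-map⁻ residue (∈-resp-↭ x∷xs↭ w∈)

      <M : ∀ {w} → w ∈ x ∷ xs → w < M
      <M w∈ with preimage w∈
      ... | b , _ , refl = m%n<n (toℕ b) M

      target : ∀ {v} → v ∈ xs ⊎ v ≡ x + M → ∃ λ c → c ∈ bs × (v ≡ residue c ⊎ v ≡ residue c + M)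
      target (inj₁ v∈) = let c , c∈ , eq = preimage (there v∈) in c , c∈ , inj₁ eq
      target (inj₂ v≡) = let c , c∈ , eq = preimage (here refl) in c , c∈ , inj₂ (trans v≡ (cong (_+ M) eq))

      <x+M : All (_< x + M) (x ∷ xs)
      <x+M = All.tabulate λ w∈ → ≤-trans (<M w∈) (m≤n+m M x)

      x≤ : ∀ {w} → w ∈ x ∷ xs → x ≤ w
      x≤ (here refl) = ≤-refl
      x≤ (there w∈)  = <⇒≤ (All.lookup (AllPairs.head sorted) w∈)

      consecutive : ∀ {s} → s ∈ S → Consecutive (x + M) x xs s
      consecutive = All.lookup (steps-consecutive xs sorted <x+M)

      S! : Unique S
      S! = Unique.map⁻ (subst Unique (sym (starts-steps (x + M) x xs)) (AllPairs.map <⇒≢ sorted))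

    -- A gap of length `d` is a difference of two marks modulo `M`, so `differences≤g` applies. A
    -- lone residue is treated separately: its only gap runs from a mark to itself and is a single
    -- one.
    gap-multiplicity : ∀ d → length (filter (λ s → gap s ≟ d) S) ≤ g
    gap-multiplicity = go xs refl
      where
      go : ∀ ys → xs ≡ ys → ∀ d → length (filter (λ s → gap s ≟ d) S) ≤ g
      go []       refl d = begin
        length (filter (λ s → gap s ≟ d) S) ≤⟨ length-filter (λ s → gap s ≟ d) S ⟩
        1                                   ≤⟨ >-nonZero⁻¹ g ⟩
        g                                   ∎
        where open ≤-Reasoning
      -- The end of a step is written as start plus length, since it may be a residue or a residue
      -- raised by `M`.
      go (y ∷ ys) refl d = differences≤g (λ (b , c) → residue b , residue b + d) (+ d) (Unique.filter⁺ D? S!) lift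
        where
        D? : Decidable (λ s → gap s ≡ d)
        D? s = gap s ≟ d

        lift : ∀ {p} → p ∈ filter D? S → ∃ λ bc → p ≡ (residue (proj₁ bc) , residue (proj₁ bc) + d) × Difference (+ d) bc
        lift {u , v} p∈ with ∈-filter⁻ D? {xs = S} p∈
        ... | s∈ , refl with consecutive s∈
        ... | consec@(u∈ , v∈ , u<v , _) with preimage u∈ | target v∈
        ... | b , b∈ , refl | c , c∈ , v≡ =
          (b , c) , cong (u ,_) (sym (m+[n∸m]≡n (<⇒≤ u<v))) , bs⊆ b∈ , bs⊆ c∈ , b≢c v≡ , divisible
          where
          b≢c : v ≡ residue c ⊎ v ≡ residue c + M → b ≢ c
          b≢c (inj₁ v≡u)   refl = <⇒≢ u<v (sym v≡u)
          -- Here the step would go once round from `u` to itself, a gap of `M`, which `gap-proper`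
          -- excludes.
          b≢c (inj₂ v≡u+M) refl = <⇒≢ (gap-proper sorted <x+M consec) (begin
            v ∸ u       ≡⟨ cong (_∸ u) v≡u+M ⟩
            u + M ∸ u   ≡⟨ m+n∸m≡n u M ⟩
            M           ≡⟨ m+n∸m≡n x M ⟨
            x + M ∸ x   ∎)
            where open ≡-Reasoning

          M∣residue-v : v ≡ residue c ⊎ v ≡ residue c + M → + M ℤ.∣ + residue c ℤ.- + v
          M∣residue-v (inj₁ eq) = ℤ.divides 0ℤ (ℤ.i≡j⇒i-j≡0 (cong +_ (sym eq)))
          M∣residue-v (inj₂ eq) = ℤ.divides ℤ.-1ℤ (begin
            + residue c ℤ.- + v                         ≡⟨ cong (λ v → + residue c ℤ.- + v) eq ⟩
            + residue c ℤ.- + (residue c + M)           ≡⟨ cong (λ v → + residue c ℤ.- v) (ℤ.pos-+ (residue c) M) ⟩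
            + residue c ℤ.- (+ residue c ℤ.+ + M)       ≡⟨ cancel (+ residue c) (+ M) ⟩
            ℤ.-1ℤ ℤ.* + M                               ∎)
            where
            open ≡-Reasoning
            cancel : ∀ i j → i ℤ.- (i ℤ.+ j) ≡ ℤ.-1ℤ ℤ.* j
            cancel = ℤ.solve-∀

          rearrange : ∀ b c i j v → (c ℤ.- j) ℤ.- (b ℤ.- i) ℤ.+ (j ℤ.- v) ≡ (c ℤ.- b) ℤ.- (v ℤ.- i)
          rearrange = ℤ.solve-∀

          divisible : + M ℤ.∣ (+ toℕ c ℤ.- + toℕ b) ℤ.- + (v ∸ u)
          divisible = subst (+ M ℤ.∣_)
            (trans (rearrange (+ toℕ b) (+ toℕ c) (+ u) (+ residue c) (+ v))
                   (cong (λ z → (+ toℕ c ℤ.- + toℕ b) ℤ.- z) (trans (ℤ.m-n≡m⊖n v u) (ℤ.⊖-≥ (<⇒≤ u<v)))))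
            (ℤ.∣m∣n⇒∣m+n (ℤ.∣m∣n⇒∣m-n (n∣i-i%n (+ toℕ c) M) (n∣i-i%n (+ toℕ b) M)) (M∣residue-v v≡))

    longest-gap : ∃ λ s → s ∈ S × All (λ t → gap t ≤ gap s) S
    longest-gap = maximal gap S (subst (0 <_) (sym (length-steps (x + M) x xs)) (s≤s z≤n))

    -- This is `multiplicity-bound` for `n` gaps with sum `M`, all below `suc L`. For `n = a g + r`
    -- it amounts to `M + g a (a - 1) / 2 + r a ≤ n L`.
    longest-gap-bound : ∀ a → let L = gap (proj₁ longest-gap) ; n = length bs in
      2 * (M + suc a * n) ≤ 2 * (n * suc L) + g * (a * suc a)
    longest-gap-bound a = subst₂ (λ s n → 2 * (s + suc a * n) ≤ 2 * (n * suc L) + g * (a * suc a))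
      (+-cancelˡ-≡ x _ _ (sum-gaps xs sorted <x+M))
      (trans (length-steps (x + M) x xs) (trans (↭-length x∷xs↭) (length-map residue bs)))
      (multiplicity-bound gap g a (suc L) S (All.map s≤s (proj₂ (proj₂ longest-gap))) gap-multiplicity)
      where L = gap (proj₁ longest-gap)

    cut-at-longest-gap : ∃ λ (Q : Ruler g (length bs)) →
      + diameter (Ruler.marks Q) ≤ℤ + M ℤ.- + gap (proj₁ longest-gap)
    cut-at-longest-gap with longest-gap
    ... | s@(u , v) , s∈ , _ with consecutive s∈
    ... | u∈ , v∈ , u<v , between =
      record { marks = cut ; unique = cut! ; size = length-map mark bs ; golomb = cut-golomb } , (begin
        + diameter cut         ≤⟨ diameter≤ cut (ℤ.+≤+ (≤-trans v≤x+M (+-monoˡ-≤ M (x≤ u∈)))) (All.map⁺ (All.tabulate bounds)) ⟩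
        + (u + M) ℤ.- + v      ≡⟨ cong (ℤ._- + v) (ℤ.pos-+ u M) ⟩
        + u ℤ.+ + M ℤ.- + v    ≡⟨ rearrange (+ u) (+ v) (+ M) ⟩
        + M ℤ.- (+ v ℤ.- + u)  ≡⟨ cong (λ z → + M ℤ.- z) (trans (ℤ.m-n≡m⊖n v u) (ℤ.⊖-≥ (<⇒≤ u<v))) ⟩
        + M ℤ.- + (v ∸ u)      ∎)
      where
      open ℤ.≤-Reasoning
      open Cut bs bs⊆ distinct u

      rearrange : ∀ u v m → u ℤ.+ m ℤ.- v ≡ m ℤ.- (v ℤ.- u)
      rearrange = ℤ.solve-∀

      -- As `x` is the smallest residue, this puts `v` at or below every residue raised by `M`.
      v≤x+M : v ≤ x + M
      v≤x+M = [ (λ v∈xs → <⇒≤ (All.lookup <x+M (there v∈xs))) , ≤-reflexive ]′ v∈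

      bounds : ∀ {b} → b ∈ bs → + v ≤ℤ mark b × mark b ≤ℤ + (u + M)
      bounds {b} b∈ =
        let r∈ = ∈-resp-↭ (↭-sym x∷xs↭) (∈-map⁺ residue b∈)
            lower , upper = wrap-bounds (<M r∈) (between r∈) (≤-trans v≤x+M (+-monoˡ-≤ M (x≤ r∈)))
        in ℤ.+≤+ lower , ℤ.+≤+ upper

  ShortRuler : ℕ → Set
  ShortRuler n = ∃ λ (Q : Ruler g n) → ∃ λ L →
    + diameter (Ruler.marks Q) ≤ℤ + M ℤ.- + L ×
    (∀ a → 2 * (M + suc a * n) ≤ 2 * (n * suc L) + g * (a * suc a))

  short-ruler : ∀ n .{{_ : NonZero n}} → n ≤ k ∸ ⌊ g /2⌋ → ShortRuler n
  short-ruler n n≤ = go bs-length (sort< (map residue bs) bs-distinct)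
    where
    -- Any `n` of the chosen marks serve; keeping exactly `n` makes the number of gaps `n`.
    bs = take n T.chosen

    bs-length : length bs ≡ n
    bs-length = trans (length-take n T.chosen) (m≤n⇒m⊓n≡m (≤-trans n≤ k∸⌊g/2⌋≤chosen))

    bs-distinct : Unique (map residue bs)
    bs-distinct = subst Unique (take-map n T.chosen) (Unique.take⁺ n T.distinct)

    bs⊆ : ∀ {b} → b ∈ bs → b ∈ marks
    bs⊆ b∈ = T.chosen⊆ (⊆⇒∈ (Sublist.take-⊆ n T.chosen) b∈)

    go : ∀ {n} .{{_ : NonZero n}} → length bs ≡ n → (∃ λ rs → rs ↭ map residue bs × AllPairs _<_ rs) → ShortRuler n
    go refl ([] , rs↭ , _) = contradiction (trans (↭-length rs↭) (length-map residue bs)) (≢-nonZero⁻¹ _ ∘ sym)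
    go refl (x ∷ xs , rs↭ , sorted) =
      let Q , Q≤ = cut-at-longest-gap bs bs⊆ bs-distinct rs↭ sorted
      in Q , _ , Q≤ , longest-gap-bound bs bs⊆ bs-distinct rs↭ sorted

-- The bound for the minimum diameter

golomb-mono : ∀ {g g′ n} → g ≤ g′ → (R : Ruler g n) → Ruler g′ n
golomb-mono g≤g′ R = record
  { marks = marks ; unique = unique ; size = size ; golomb = λ d 0<d → ≤-trans (golomb d 0<d) g≤g′ }
  where open Ruler R

-- The ruler built for `g` is also a `g′`-Golomb ruler, so one construction serves every `g′ ≥ g`,
-- including `g` itself.
G≤bound : ∀ N k g n .{{_ : NonZero N}} .{{_ : NonZero k}} .{{_ : NonZero g}} .{{_ : NonZero n}} →
  ModularRuler 1 k N → g ∣ N → n ≤ k ∸ ⌊ g /2⌋ → ∀ a r → n ≡ a * g + r →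
  ∀ g′ .{{_ : NonZero g′}} → g ≤ g′ → + G g′ n ≤ℤ bound N g n a r
G≤bound N k g n R (divides M refl) n≤ a r n≡ g′ g≤g′ = main
  where
  instance
    M≢0 : NonZero M
    M≢0 = m*n≢0⇒m≢0 M

  open Reduction {M} {g} R using (short-ruler)

  Q = proj₁ (short-ruler n n≤)
  L = proj₁ (proj₂ (short-ruler n n≤))

  t = g * (a * (a ∸ 1)) / 2

  numerator≤ : M + t + r * a ≤ n * L
  -- Doubled and increased by `2 n + g a (a + 1)`, the claim becomes the estimate from `short-ruler`
  -- at `a`, with `n = a g + r` substituted in the product `a n`.
  numerator≤ = *-cancelˡ-≤ 2 (+-cancelʳ-≤ (2 * n + g * (a * suc a)) _ _ (begin
    2 * (M + t + r * a) + (2 * n + g * (a * suc a))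
      ≡⟨ rearrange₁ M t r a n (g * (a * suc a)) ⟩
    t * 2 + (2 * (M + r * a + n) + g * (a * suc a))
      -- Rounding down in `t` goes in the required direction.
      ≤⟨ +-monoˡ-≤ _ (m/n*n≤m (g * (a * (a ∸ 1))) 2) ⟩
    g * (a * (a ∸ 1)) + (2 * (M + r * a + n) + g * (a * suc a))
      ≡⟨ squares a ⟩
    2 * (M + (n + a * (a * g + r)))
      ≡⟨ cong (λ m → 2 * (M + (n + a * m))) n≡ ⟨
    2 * (M + suc a * n)
      ≤⟨ proj₂ (proj₂ (proj₂ (short-ruler n n≤))) a ⟩
    2 * (n * suc L) + g * (a * suc a)
      ≡⟨ rearrange₂ n L (g * (a * suc a)) ⟩
    2 * (n * L) + (2 * n + g * (a * suc a)) ∎))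
    where
    open ≤-Reasoning
    rearrange₁ : ∀ M t r a n z → 2 * (M + t + r * a) + (2 * n + z) ≡ t * 2 + (2 * (M + r * a + n) + z)
    rearrange₁ = solve-∀
    rearrange₂ : ∀ n L z → 2 * (n * suc L) + z ≡ 2 * (n * L) + (2 * n + z)
    rearrange₂ = solve-∀
    squares : ∀ a → g * (a * (a ∸ 1)) + (2 * (M + r * a + n) + g * (a * suc a)) ≡ 2 * (M + (n + a * (a * g + r)))
    -- The case split resolves the truncated `a ∸ 1`; at `a = 0` the factor `a` makes the product
    -- vanish.
    squares zero    = base g M r n
      where
      base : ∀ g M r n → g * 0 + (2 * (M + r * 0 + n) + g * 0) ≡ 2 * (M + (n + 0))
      base = solve-∀
    squares (suc a) = step g M r n a
      where
      step : ∀ g M r n a → g * (suc a * a) + (2 * (M + r * suc a + n) + g * (suc a * suc (suc a))) ≡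
        2 * (M + (n + suc a * (suc a * g + r)))
      step = solve-∀

  N/g≡M : M * g / g ≡ M
  N/g≡M = m*n/n≡m M g

  main : + G g′ n ≤ℤ bound (M * g) g n a r
  main rewrite N/g≡M = begin
    + G g′ n                     ≤⟨ ℤ.+≤+ (proj₂ (G-isMinDiameter g′ n) (golomb-mono g≤g′ Q)) ⟩
    + diameter (Ruler.marks Q)   ≤⟨ proj₁ (proj₂ (proj₂ (short-ruler n n≤))) ⟩
    + M ℤ.- + L                  ≤⟨ ℤ.+-monoʳ-≤ (+ M) (ℤ.neg-mono-≤ (ceiling-/≤ (M + t + r * a) n L numerator≤)) ⟩
    + M ℤ.- ℚᵘ.ceiling (+ (M + t + r * a) ℚᵘ./ n) ∎
    where open ℤ.≤-Reasoning

theorem3 : (N k g n : ℕ) .{{_ : NonZero N}} .{{_ : NonZero k}} .{{_ : NonZero g}} .{{_ : NonZero n}} →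
    ModularRuler 1 k N → g ∣ N →
    n ≤ k ∸ ⌊ g /2⌋ →
    (a r : ℕ) → n ≡ a * g + r → r < g →
    (+ G g n ≤ℤ bound N g n a r) ×
    ((g′ : ℕ) .{{_ : NonZero g′}} → g ≤ g′ → + G g′ n ≤ℤ bound N g n a r)
theorem3 N k g n R g∣N n≤ a r n≡ _ = G[g′]≤bound g ≤-refl , G[g′]≤bound
  where
  G[g′]≤bound : (g′ : ℕ) .{{_ : NonZero g′}} → g ≤ g′ → + G g′ n ≤ℤ bound N g n a r
  G[g′]≤bound = G≤bound N k g n R g∣N n≤ a r n≡
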